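{- For every finite simple graph $G$, $\operatorname{box}(G) \le \operatorname{tw}(G) + 2$.
   Context: An axis-parallel $b$-dimensional box is a Cartesian product $R_1\times\cdots\times R_b$ of closed real intervals $R_i=[a_i,b_i]$. The boxicity $\operatorname{box}(G)$ of a graph $G$ is the minimum $b$ such that $G$ is the intersection graph of a family of axis-parallel $b$-dimensional boxes (one box per vertex, two distinct vertices adjacent iff their boxes intersect). A tree decomposition of $G=(V,E)$ is a pair $(\{X_i : i\in I\},T)$ with $T$ a tree on node set $I$ and $X_i\subseteq V$, such that $\bigcup_i X_i=V$, every edge has both endpoints in some $X_i$, and whenever $j$ lies on the path in $T$ from $i$ to $k$ we have $X_i\cap X_k\subseteq X_j$. Its width is $\max_i |X_i|-1$, and the treewidth $\operatorname{tw}(G)$ is the minimum width of a tree decomposition of $G$. -}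

module Defs where

open import Data.Empty using (⊥; ⊥-elim)
open import Data.Fin using (Fin; zero)
open import Data.Fin.Properties using () renaming (_≟_ to _≟ᶠ_)
open import Data.Fin.Subset using (Subset; _∈_; _⊆_; _∩_; ∣_∣; ⊤)
open import Data.Fin.Subset.Properties using (∈⊤)
open import Data.Integer using (ℤ; +_; 1ℤ)
open import Data.List using (List; []; _∷_; length)
open import Data.Nat using (ℕ; _⊔_; NonZero)
open import Data.Product using (Σ; ∃; _×_; _,_; proj₁; proj₂)
open import Data.Rational using (ℚ; 0ℚ; 1ℚ; _<_; _<?_)
open import Data.Sum using (_⊎_; inj₁; inj₂)
open import Data.Vec.Functional using (Vector; foldr)
open import Function.Bundles using (_⇔_; mk⇔)
open import Level using (0ℓ; Level)
open import Relation.Binary.Core using (Rel)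
open import Relation.Binary.Definitions using (Decidable; Symmetric; Irreflexive)
open import Relation.Binary.PropositionalEquality using (_≡_; _≢_; refl; sym; subst)
open import Relation.Nullary using (¬_; Dec; yes; no)
import Data.Integer as ℤ
import Data.Integer.Properties as ℤ
import Data.List.Membership.Propositional as List
import Data.List.Relation.Unary.Unique.Propositional as List
import Data.Nat as ℕ
import Data.Nat.Induction as ℕ
import Data.Nat.Properties as ℕ
import Data.Rational as ℚ
import Data.Rational.Properties as ℚ

-- Two-sided Dedekind cuts of ℚ.
record ℝ : Set₁ where
  field
    L U         : ℚ → Set
    L-inhabited : ∃ L
    U-inhabited : ∃ U
    L-rounded   : ∀ q → L q ⇔ (∃ λ r → q < r × L r)
    U-rounded   : ∀ r → U r ⇔ (∃ λ q → q < r × U q)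
    disjoint    : ∀ q → ¬ (L q × U q)
    located     : ∀ {q r} → q < r → L q ⊎ U r

infix 4 _≤ᴿ_
_≤ᴿ_ : ℝ → ℝ → Set
x ≤ᴿ y = ∀ {q} → ℝ.L x q → ℝ.L y q

record Graph (n : ℕ) : Set₁ where
  field
    Adj        : Rel (Fin n) 0ℓ
    adj?       : Decidable Adj
    adj-sym    : Symmetric Adj
    adj-irrefl : Irreflexive _≡_ Adj

record Interval : Set₁ where
  field
    lo hi : ℝ
    lo≤hi : lo ≤ᴿ hi

_∈ᴵ_ : ℝ → Interval → Set
x ∈ᴵ R = Interval.lo R ≤ᴿ x × x ≤ᴿ Interval.hi R

Box : ℕ → Set₁
Box b = Vector Interval b

_∈ᴮ_ : ∀ {b} → Vector ℝ b → Box b → Set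
x ∈ᴮ B = ∀ i → x i ∈ᴵ B i

Intersect : ∀ {b} → Box b → Box b → Set₁
Intersect {b} B C = Σ (Vector ℝ b) λ x → x ∈ᴮ B × x ∈ᴮ C

record BoxRepresentation {n} (G : Graph n) (b : ℕ) : Set₁ where
  open Graph G
  field
    box       : Fin n → Box b
    represent : ∀ u v → u ≢ v → Adj u v ⇔ Intersect (box u) (box v)

IsBoxicity : ∀ {n} → Graph n → ℕ → Set₁
IsBoxicity G b =
  BoxRepresentation G b × (∀ k → BoxRepresentation G k → b ℕ.≤ k)

module _ {n} (G : Graph n) where
  open Graph G

  data Walk : Fin n → Fin n → Set where
    stop : ∀ {u} → Walk u u
    step : ∀ {u v w} → Adj u v → Walk v w → Walk u w

  vertices : ∀ {u v} → Walk u v → List (Fin n)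
  vertices {u} stop       = u ∷ []
  vertices {u} (step _ p) = u ∷ vertices p

  IsPath : ∀ {u v} → Walk u v → Set
  IsPath p = List.Unique (vertices p)

  Connected : Set
  Connected = ∀ u v → Walk u v

  -- A cycle is a path on at least three vertices together with an edge
  -- joining its last vertex to its first.
  Acyclic : Set
  Acyclic = ∀ {u v} (p : Walk u v) → IsPath p →
            3 ℕ.≤ length (vertices p) → ¬ Adj v u

  record IsTree : Set where
    field
      nonEmpty  : NonZero n
      connected : Connected
      acyclic   : Acyclic

record TreeDecomposition {n} (G : Graph n) : Set₁ where
  open Graph G
  field
    {size}       : ℕ
    T            : Graph size
    isTree       : IsTree T
    X            : Fin size → Subset n
    coversVertex : ∀ v → ∃ λ i → v ∈ X i
    coversEdge   : ∀ {u v} → Adj u v → ∃ λ i → u ∈ X i × v ∈ X i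
    coherent     : ∀ {i j k} (p : Walk T i k) → IsPath T p →
                   j List.∈ vertices T p → X i ∩ X k ⊆ X j

  maxBagSize : ℕ
  maxBagSize = foldr _⊔_ 0 (λ i → ∣ X i ∣)

  -- An integer, since the graph without vertices has width -1.
  width : ℤ
  width = + maxBagSize ℤ.- 1ℤ

IsTreewidth : ∀ {n} → Graph n → ℤ → Set₁
IsTreewidth G t =
  (Σ (TreeDecomposition G) λ D → TreeDecomposition.width D ≡ t) ×
  (∀ (D : TreeDecomposition G) → t ℤ.≤ TreeDecomposition.width D)

-- Both minima exist for every graph, up to the double negation that a
-- minimum of an undecided set of naturals requires.
¬¬-minimum : ∀ {ℓ : Level} (P : ℕ → Set ℓ) n → P n →
             ¬ ¬ (∃ λ m → P m × (∀ k → P k → m ℕ.≤ k))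
¬¬-minimum P = ℕ.<-rec _ λ n rec Pn ¬min →
  ¬min (n , Pn , λ k Pk → ℕ.≮⇒≥ λ k<n → rec k<n Pk ¬min)

fromℚ : ℚ → ℝ
fromℚ p = record
  { L           = _< p
  ; U           = p <_
  ; L-inhabited = p ℚ.- 1ℚ , below
  ; U-inhabited = p ℚ.+ 1ℚ , above
  ; L-rounded   = λ q → mk⇔ (λ q<p → let r , q<r , r<p = ℚ.<-dense q<p in r , q<r , r<p)
                            (λ (r , q<r , r<p) → ℚ.<-trans q<r r<p)
  ; U-rounded   = λ r → mk⇔ (λ p<r → let q , p<q , q<r = ℚ.<-dense p<r in q , q<r , p<q)
                            (λ (q , q<r , p<q) → ℚ.<-trans p<q q<r)
  ; disjoint    = λ q (q<p , p<q) → ℚ.<-asym q<p p<q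
  ; located     = λ {q} {r} → split q r
  }
  where
  below : p ℚ.- 1ℚ < p
  below = subst (p ℚ.- 1ℚ <_) (ℚ.+-identityʳ p)
            (ℚ.+-monoʳ-< p (ℚ.negative⁻¹ (ℚ.- 1ℚ)))
  above : p < p ℚ.+ 1ℚ
  above = subst (_< p ℚ.+ 1ℚ) (ℚ.+-identityʳ p)
            (ℚ.+-monoʳ-< p (ℚ.positive⁻¹ 1ℚ))
  split : ∀ q r → q < r → q < p ⊎ p < r
  split q r q<r with q <? p
  ... | yes q<p = inj₁ q<p
  ... | no  q≮p = inj₂ (ℚ.≤-<-trans (ℚ.≮⇒≥ q≮p) q<r)

private
  0≤1 : fromℚ 0ℚ ≤ᴿ fromℚ 1ℚ
  0≤1 q<0 = ℚ.<-trans q<0 (ℚ.positive⁻¹ 1ℚ)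

  1≰0 : ¬ (fromℚ 1ℚ ≤ᴿ fromℚ 0ℚ)
  1≰0 1≤0 = ℚ.<-irrefl refl (1≤0 (ℚ.positive⁻¹ 1ℚ))

-- Coordinate k separates the vertex k, at [0,0], from its
-- non-neighbours, at [1,1]; its neighbours get [0,1].
trivialBoxRepresentation : ∀ {n} (G : Graph n) → BoxRepresentation G n
trivialBoxRepresentation {n} G = record { box = box ; represent = represent }
  where
  open Graph G

  interval : ∀ {u k : Fin n} → Dec (u ≡ k) → Dec (Adj u k) → Interval
  interval (yes _) _       = record { lo = fromℚ 0ℚ ; hi = fromℚ 0ℚ ; lo≤hi = λ z → z }
  interval (no _)  (yes _) = record { lo = fromℚ 0ℚ ; hi = fromℚ 1ℚ ; lo≤hi = 0≤1 }
  interval (no _)  (no _)  = record { lo = fromℚ 1ℚ ; hi = fromℚ 1ℚ ; lo≤hi = λ z → z }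

  box : Fin n → Box n
  box u k = interval (u ≟ᶠ k) (adj? u k)

  meet : ∀ {u v k} → u ≢ v → Adj u v →
         (a : Dec (u ≡ k)) (b : Dec (Adj u k)) (c : Dec (v ≡ k)) (d : Dec (Adj v k)) →
         Σ ℝ λ x → x ∈ᴵ interval a b × x ∈ᴵ interval c d
  meet u≢v uv (yes refl) _ (yes refl) _ = ⊥-elim (u≢v refl)
  meet u≢v uv (yes refl) _ (no _) (yes _) =
    fromℚ 0ℚ , ((λ z → z) , (λ z → z)) , ((λ z → z) , 0≤1)
  meet u≢v uv (yes refl) _ (no _) (no ¬vu) = ⊥-elim (¬vu (adj-sym uv))
  meet u≢v uv (no _) (yes _) (yes refl) _ =
    fromℚ 0ℚ , ((λ z → z) , 0≤1) , ((λ z → z) , (λ z → z))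
  meet u≢v uv (no _) (no ¬uv) (yes refl) _ = ⊥-elim (¬uv uv)
  meet u≢v uv (no _) (yes _) (no _) (yes _) = fromℚ 1ℚ , (0≤1 , (λ z → z)) , (0≤1 , (λ z → z))
  meet u≢v uv (no _) (yes _) (no _) (no _)  = fromℚ 1ℚ , (0≤1 , (λ z → z)) , ((λ z → z) , (λ z → z))
  meet u≢v uv (no _) (no _)  (no _) (yes _) = fromℚ 1ℚ , ((λ z → z) , (λ z → z)) , (0≤1 , (λ z → z))
  meet u≢v uv (no _) (no _)  (no _) (no _)  = fromℚ 1ℚ , ((λ z → z) , (λ z → z)) , ((λ z → z) , (λ z → z))

  adjacent : ∀ {u v x} → u ≢ v →
             (a : Dec (u ≡ u)) (b : Dec (Adj u u)) (c : Dec (v ≡ u)) (d : Dec (Adj v u)) →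
             x ∈ᴵ interval a b → x ∈ᴵ interval c d → Adj u v
  adjacent u≢v (no u≢u) _ _ _ _ _ = ⊥-elim (u≢u refl)
  adjacent u≢v (yes _) _ (yes v≡u) _ _ _ = ⊥-elim (u≢v (sym v≡u))
  adjacent u≢v (yes _) _ (no _) (yes vu) _ _ = adj-sym vu
  adjacent u≢v (yes _) _ (no _) (no _) (_ , x≤0) (1≤x , _) =
    ⊥-elim (1≰0 λ {q} z → x≤0 {q} (1≤x {q} z))

  represent : ∀ u v → u ≢ v → Adj u v ⇔ Intersect (box u) (box v)
  represent u v u≢v = mk⇔
    (λ uv → let m k = meet u≢v uv (u ≟ᶠ k) (adj? u k) (v ≟ᶠ k) (adj? v k) in
      (λ k → proj₁ (m k)) , (λ k → proj₁ (proj₂ (m k))) , (λ k → proj₂ (proj₂ (m k))))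
    (λ (x , x∈u , x∈v) →
      adjacent {x = x u} u≢v (u ≟ᶠ u) (adj? u u) (v ≟ᶠ u) (adj? v u) (x∈u u) (x∈v u))

boxicity-exists : ∀ {n} (G : Graph n) → ¬ ¬ ∃ (IsBoxicity G)
boxicity-exists {n} G = ¬¬-minimum (BoxRepresentation G) n (trivialBoxRepresentation G)

trivialTreeDecomposition : ∀ {n} (G : Graph n) → TreeDecomposition G
trivialTreeDecomposition G = record
  { T            = point
  ; isTree       = record
    { nonEmpty  = _
    ; connected = λ { zero zero → stop }
    ; acyclic   = λ { {zero} {zero} _ _ _ () }
    }
  ; X            = λ _ → ⊤
  ; coversVertex = λ _ → zero , ∈⊤
  ; coversEdge   = λ _ → zero , ∈⊤ , ∈⊤
  ; coherent     = λ _ _ _ _ → ∈⊤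
  }
  where
  point : Graph 1
  point = record
    { Adj = λ _ _ → ⊥ ; adj? = λ _ _ → no λ () ; adj-sym = λ () ; adj-irrefl = λ _ () }

treewidth-exists : ∀ {n} (G : Graph n) → ¬ ¬ ∃ (IsTreewidth G)
treewidth-exists G ¬tw = ¬¬-minimum
  (λ m → Σ (TreeDecomposition G) λ D → maxBagSize D ≡ m) _
  (trivialTreeDecomposition G , refl)
  λ { (m , (D , refl) , least) → ¬tw (width D , (D , refl) ,
        λ D′ → ℤ.+-monoˡ-≤ (ℤ.- 1ℤ) (ℤ.+≤+ (least _ (D′ , refl)))) }
  where open TreeDecomposition

{-# OPTIONS --safe #-}

-- Root the decomposition tree, let top v be the shallowest node whose bag contains v, and
-- colour the vertices greedily from the root down with w = tw(G) + 1 colours so that vertices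
-- sharing a bag get different colours.  Assign to the nodes nested-or-disjoint intervals, one
-- inside the other exactly when the nodes are comparable.  One coordinate gives v the interval
-- of top v; it separates the pairs whose tops are incomparable and no adjacent pair.  In the
-- coordinate of colour c, a vertex of colour c is the left end of the interval of its top, and
-- any other vertex v gets the interval of top v, prolonged to the left up to its neighbour of
-- colour c in the bag of top v, if any.  If u, v are non-adjacent with top u above top v, the
-- coordinate of the colour of u separates them.  Altogether w + 1 coordinates are used.

module Submission where

open import Defs
open import Data.Nat using (ℕ)
open import Data.Integer using (ℤ; +_; _+_; _≤_)

open import Data.Bool using (true; false)
open import Data.Empty using (⊥-elim)
open import Data.Fin using (Fin; zero; suc; toℕ; fromℕ<)
open import Data.Fin.Properties using (any?; ¬∀⟶∃¬; pigeonhole; toℕ<n; toℕ-injective) renaming (_≟_ to _≟ᶠ_; <⇒≢ to <⇒≢ᶠ)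
open import Data.Fin.Subset using (Subset; _∈_; _-_; ∣_∣)
open import Data.Fin.Subset.Properties using (_∈?_; x∈p∩q⁺; x∈p⇒∣p-x∣<∣p∣; x∈p∧x≢y⇒x∈p-y)
open import Data.List using (List; []; _∷_; length; lookup)
open import Data.List.Relation.Unary.All using (All; []; _∷_)
open import Data.List.Relation.Unary.Any using (here; there; index)
open import Data.List.Relation.Unary.Any.Properties using (lookup-index)
open import Data.List.Relation.Unary.AllPairs using ([]; _∷_)
open import Data.Maybe using (Maybe; just; nothing)
open import Data.Maybe.Properties using (just-injective)
open import Data.Nat using (zero; suc; _∸_; _^_; _⊔_; z≤n; s≤s)
open import Data.Nat.Coprimality using (1-coprimeTo) renaming (sym to coprime-sym)
open import Data.Nat.Induction using (<-rec)
open import Data.Product using (∃; _×_; _,_; proj₁; proj₂)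
open import Data.Rational using (ℚ; mkℚ; *≤*)
open import Data.Sum using (_⊎_; inj₁; inj₂)
open import Data.Vec using ([]; _∷_; here; there)
open import Data.Vec.Functional using (Vector; foldr; updateAt)
open import Data.Vec.Functional.Properties using (updateAt-updates; updateAt-minimal)
open import Function using (_∘_; const)
open import Function.Bundles using (mk⇔)
open import Function.Definitions using (Injective)
open import Relation.Binary.Definitions using (tri<; tri≈; tri>)
open import Relation.Binary.PropositionalEquality using (_≡_; _≢_; refl; sym; trans; cong; subst; ≢-sym)
open import Relation.Nullary using (¬_; Dec; yes; no)
open import Relation.Nullary.Decidable using (_×-dec_)
open import Relation.Unary using (Decidable)
import Data.Integer as ℤ
import Data.Integer.Properties as ℤ
import Data.List.Membership.DecPropositional as DecMembership
import Data.List.Membership.Propositional as List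
import Data.List.Relation.Unary.All as All
import Data.Nat as ℕ
import Data.Nat.Properties as ℕ
import Data.Rational as ℚ
import Data.Rational.Properties as ℚ

-- Minima of decidable predicates and maxima of finite families.

least : {P : ℕ → Set} → Decidable P → ∀ n → P n → ∃ λ m → P m × (∀ k → P k → m ℕ.≤ k)
least {P} P? = <-rec _ go
  where
  go : ∀ n → (∀ {m} → m ℕ.< n → P m → ∃ λ m → P m × (∀ k → P k → m ℕ.≤ k)) →
       P n → ∃ λ m → P m × (∀ k → P k → m ℕ.≤ k)
  go n rec Pn with ℕ.anyUpTo? P? n
  ... | yes (m , m<n , Pm) = rec m<n Pm
  ... | no  none           = n , Pn , λ k Pk → ℕ.≮⇒≥ λ k<n → none (k , k<n , Pk)

minimiser : ∀ {s} {P : Fin s → Set} → Decidable P → (f : Fin s → ℕ) → ∃ P →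
            ∃ λ i → P i × (∀ j → P j → f i ℕ.≤ f j)
minimiser {P = P} P? f (i , Pi)
  with least (λ k → any? λ j → P? j ×-dec (f j ℕ.≟ k)) (f i) (i , Pi , refl)
... | _ , (m , Pm , refl) , min = m , Pm , λ j Pj → min (f j) (j , Pj , refl)

≤-maximum : ∀ {s} (f : Vector ℕ s) i → f i ℕ.≤ foldr _⊔_ 0 f
≤-maximum f zero    = ℕ.m≤m⊔n _ _
≤-maximum f (suc i) = ℕ.≤-trans (≤-maximum (f ∘ suc) i) (ℕ.m≤n⊔m _ _)

-- Greedy colouring

image : ∀ {n} {A : Set} → Subset n → (Fin n → A) → List A
image []          f = []
image (true  ∷ p) f = f zero ∷ image p (f ∘ suc)
image (false ∷ p) f = image p (f ∘ suc)

length-image : ∀ {n} {A : Set} (p : Subset n) (f : Fin n → A) → length (image p f) ≡ ∣ p ∣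
length-image []          f = refl
length-image (true  ∷ p) f = cong suc (length-image p (f ∘ suc))
length-image (false ∷ p) f = length-image p (f ∘ suc)

∈-image : ∀ {n} {A : Set} {p : Subset n} (f : Fin n → A) {x} → x ∈ p → f x List.∈ image p f
∈-image {p = true  ∷ _} f here        = here refl
∈-image {p = true  ∷ _} f (there x∈p) = there (∈-image (f ∘ suc) x∈p)
∈-image {p = false ∷ _} f (there x∈p) = ∈-image (f ∘ suc) x∈p

-- Each colour can be read off from its position in the list, so two colours cannot share a
-- position, and the pigeonhole principle applies.
covering⇒≤ : ∀ {w} (xs : List (Fin w)) → (∀ c → c List.∈ xs) → w ℕ.≤ length xs
covering⇒≤ xs covered = ℕ.≮⇒≥ λ xs<w →
  let i , j , i<j , eq = pigeonhole xs<w (index ∘ covered)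
  in <⇒≢ᶠ i<j (trans (lookup-index (covered i))
       (trans (cong (lookup xs) eq) (sym (lookup-index (covered j)))))

fresh : ∀ {w} (xs : List (Fin w)) → length xs ℕ.< w → ∃ λ c → c List.∉ xs
fresh {w} xs xs<w = ¬∀⟶∃¬ w (List._∈ xs) (_∈ˡ? xs) (ℕ.<⇒≱ xs<w ∘ covering⇒≤ xs)
  where open DecMembership (_≟ᶠ_ {w}) renaming (_∈?_ to _∈ˡ?_)

module Greedy {n w} (key : Fin n → ℕ) (key-injective : Injective _≡_ _≡_ key)
  (back : Fin n → Subset n) (v∈back : ∀ v → v ∈ back v) (∣back∣≤w : ∀ v → ∣ back v ∣ ℕ.≤ w) where

  -- The colouring is total, but only vertices with key below `k` are constrained; its values
  -- elsewhere are placeholders.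
  ProperBelow : ℕ → (Fin n → Fin w) → Set
  ProperBelow k θ = ∀ u v → key v ℕ.< k → key u ℕ.< key v → u ∈ back v → θ u ≢ θ v

  extend : ∀ k → ∃ (ProperBelow k) → ∃ (ProperBelow (suc k))
  extend k (θ , proper) with any? (λ v → key v ℕ.≟ k)
  ... | no none = θ , λ u v v<1+k → proper u v
                    (ℕ.≤∧≢⇒< (ℕ.≤-pred v<1+k) λ eq → none (v , eq))
  ... | yes (v₀ , refl) = updateAt θ v₀ (const c) , proper′
    where
    others : Subset n
    -- Dropping `v₀` itself leaves fewer than `w` colours to avoid.
    others = back v₀ - v₀

    found : ∃ λ c → c List.∉ image others θ
    found = fresh (image others θ) (subst (ℕ._< w) (sym (length-image others θ))
              (ℕ.<-≤-trans (x∈p⇒∣p-x∣<∣p∣ (v∈back v₀)) (∣back∣≤w v₀)))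

    c : Fin w
    c = proj₁ found

    proper′ : ProperBelow (suc (key v₀)) (updateAt θ v₀ (const c))
    proper′ u v v<1+k u<v u∈back eq with v ≟ᶠ v₀
    ... | yes refl = proj₂ found (subst (List._∈ image others θ)
                       (trans (sym (updateAt-minimal u v θ u≢v)) (trans eq (updateAt-updates v θ)))
                       (∈-image θ (x∈p∧x≢y⇒x∈p-y u∈back u≢v)))
      where
      u≢v : u ≢ v
      u≢v refl = ℕ.<-irrefl refl u<v
    ... | no v≢v₀ = proper u v v<v₀ u<v u∈back
                      (trans (sym (updateAt-minimal u v₀ θ u≢v₀)) (trans eq (updateAt-minimal v v₀ θ v≢v₀)))
      where
      v<v₀ : key v ℕ.< key v₀
      v<v₀ = ℕ.≤∧≢⇒< (ℕ.≤-pred v<1+k) (v≢v₀ ∘ key-injective)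
      u≢v₀ : u ≢ v₀
      u≢v₀ refl = ℕ.<-asym u<v v<v₀

  properBelow : ∀ k → ∃ (ProperBelow k)
  -- The placeholder is colour 0, which exists because `back v` contains `v` and so `w` is positive.
  properBelow zero    = (λ v → fromℕ< (ℕ.<-≤-trans (ℕ.≤-<-trans z≤n (x∈p⇒∣p-x∣<∣p∣ (v∈back v))) (∣back∣≤w v)))
                      , λ _ _ ()
  properBelow (suc k) = extend k (properBelow k)

  colouring : ∃ λ (θ : Fin n → Fin w) → ∀ u v → key u ℕ.< key v → u ∈ back v → θ u ≢ θ v
  colouring with properBelow (suc (foldr _⊔_ 0 key))
  ... | θ , proper = θ , λ u v → proper u v (s≤s (≤-maximum key v))

*+-mono-< : ∀ {n d d′ j} j′ → d ℕ.< d′ → j ℕ.< n → d ℕ.* n ℕ.+ j ℕ.< d′ ℕ.* n ℕ.+ j′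
*+-mono-< {n} {d} {d′} {j} j′ d<d′ j<n = begin-strict
  d ℕ.* n ℕ.+ j    <⟨ ℕ.+-monoʳ-< (d ℕ.* n) j<n ⟩
  d ℕ.* n ℕ.+ n    ≡⟨ ℕ.+-comm (d ℕ.* n) n ⟩
  suc d ℕ.* n      ≤⟨ ℕ.*-monoˡ-≤ n d<d′ ⟩
  d′ ℕ.* n         ≤⟨ ℕ.m≤m+n _ j′ ⟩
  d′ ℕ.* n ℕ.+ j′  ∎
  where open ℕ.≤-Reasoning

-- The order in which vertices are coloured.

module LexKey {n} (level : Fin n → ℕ) where

  -- A two-digit number in base `n`: the level leads, and the index of the vertex breaks ties.
  key : Fin n → ℕ
  key v = level v ℕ.* n ℕ.+ toℕ v

  key-level : ∀ u v → key u ℕ.≤ key v → level u ℕ.≤ level v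
  key-level u v u≤v = ℕ.≮⇒≥ λ v<u →
    ℕ.<⇒≱ (*+-mono-< (toℕ u) v<u (toℕ<n v)) u≤v

  key-injective : Injective _≡_ _≡_ key
  key-injective {u} {v} eq = toℕ-injective (ℕ.+-cancelˡ-≡ (level v ℕ.* n) (toℕ u) (toℕ v)
    (subst (λ l → l ℕ.* n ℕ.+ toℕ u ≡ key v) levels eq))
    where
    levels : level u ≡ level v
    levels = ℕ.≤-antisym (key-level u v (ℕ.≤-reflexive eq)) (key-level v u (ℕ.≤-reflexive (sym eq)))

-- Rooted spanning trees

record SpanningTree {s} (T : Graph s) : Set where
  open Graph T
  field
    root         : Fin s
    depth        : Fin s → ℕ
    parent       : Fin s → Maybe (Fin s)
    orphan       : ∀ {x} → parent x ≡ nothing → x ≡ root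
    parent-adj   : ∀ {x p} → parent x ≡ just p → Adj x p
    parent-depth : ∀ {x p} → parent x ≡ just p → depth x ≡ suc (depth p)

module BreadthFirst {s} (T : Graph s) (root : Fin s) (connected : Connected T) where
  open Graph T

  -- Counting the steps makes the existence of a walk to the root decidable, so that a least length
  -- can be searched for.
  Reach : ℕ → Fin s → Set
  Reach zero    x = x ≡ root
  Reach (suc k) x = ∃ λ y → Adj x y × Reach k y

  reach? : ∀ k → Decidable (Reach k)
  reach? zero    x = x ≟ᶠ root
  reach? (suc k) x = any? λ y → adj? x y ×-dec reach? k y

  walk⇒reach : ∀ {x} → Walk T x root → ∃ λ k → Reach k x
  walk⇒reach stop       = 0 , refl
  walk⇒reach (step a p) with walk⇒reach p
  ... | k , r = suc k , _ , a , r

  distance : ∀ x → ∃ λ d → Reach d x × (∀ k → Reach k x → d ℕ.≤ k)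
  distance x with walk⇒reach (connected x root)
  ... | k , r = least (λ k → reach? k x) k r

  depth : Fin s → ℕ
  depth x = proj₁ (distance x)

  -- The rest of a shortest walk is shortest, since a shorter one from `y` would shorten the walk
  -- from `x`.
  predecessor : ∀ x → x ≡ root ⊎ ∃ λ y → Adj x y × depth x ≡ suc (depth y)
  predecessor x with distance x
  ... | zero  , r           , _   = inj₁ r
  ... | suc d , (y , a , r) , min = inj₂ (y , a , cong suc
    (ℕ.≤-antisym (ℕ.≤-pred (min _ (y , a , proj₁ (proj₂ (distance y)))))
                 (proj₂ (proj₂ (distance y)) d r)))

  parent : Fin s → Maybe (Fin s)
  parent x with predecessor x
  ... | inj₁ _       = nothing
  ... | inj₂ (y , _) = just y

  orphan : ∀ {x} → parent x ≡ nothing → x ≡ root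
  orphan {x} eq with predecessor x
  orphan refl | inj₁ x≡root = x≡root
  orphan ()   | inj₂ _

  parent-step : ∀ {x p} → parent x ≡ just p → Adj x p × depth x ≡ suc (depth p)
  parent-step {x} eq with predecessor x
  parent-step ()   | inj₁ _
  parent-step refl | inj₂ (_ , edge) = edge

  spanningTree : SpanningTree T
  spanningTree = record
    { root = root ; depth = depth ; parent = parent ; orphan = orphan
    ; parent-adj = proj₁ ∘ parent-step ; parent-depth = proj₂ ∘ parent-step }

-- The ancestor order.

module Ancestors {s} {T : Graph s} (S : SpanningTree T) where
  open Graph T
  open SpanningTree S

  infix 4 _⊑_

  data _⊑_ (a : Fin s) : Fin s → Set where
    self  : a ⊑ a
    below : ∀ {x p} → parent x ≡ just p → a ⊑ p → a ⊑ x

  ⊑-depth : ∀ {a x} → a ⊑ x → depth a ℕ.≤ depth x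
  ⊑-depth self         = ℕ.≤-refl
  ⊑-depth (below px s) rewrite parent-depth px = ℕ.m≤n⇒m≤1+n (⊑-depth s)

  ⊑-trans : ∀ {a b c} → a ⊑ b → b ⊑ c → a ⊑ c
  ⊑-trans ab self          = ab
  ⊑-trans ab (below px bp) = below px (⊑-trans ab bp)

  ⊑-equal-depth : ∀ {a x} → a ⊑ x → depth x ℕ.≤ depth a → a ≡ x
  ⊑-equal-depth self         _   = refl
  ⊑-equal-depth (below px s) x≤a rewrite parent-depth px =
    ⊥-elim (ℕ.<⇒≱ (s≤s (⊑-depth s)) x≤a)

  -- `parent` is a function, so both chains climb from `x` through the same nodes until one of them
  -- ends.
  ⊑-comparable : ∀ {a b x} → a ⊑ x → b ⊑ x → a ⊑ b ⊎ b ⊑ a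
  ⊑-comparable self         bx           = inj₂ bx
  ⊑-comparable ax@(below _ _) self       = inj₁ ax
  ⊑-comparable (below px s) (below qx t)
    with refl ← just-injective (trans (sym px) qx) = ⊑-comparable s t

  root-⊑ : ∀ x → root ⊑ x
  root-⊑ x = go (depth x) x ℕ.≤-refl
    where
    -- `k` bounds the depth, which falls by one at each parent.
    go : ∀ k x → depth x ℕ.≤ k → root ⊑ x
    go k x x≤k with parent x in eq
    ... | nothing = subst (root ⊑_) (sym (orphan eq)) self
    go zero    x x≤0 | just p with () ← subst (ℕ._≤ 0) (parent-depth eq) x≤0
    go (suc k) x x≤k | just p =
      below eq (go k p (ℕ.≤-pred (subst (ℕ._≤ suc k) (parent-depth eq) x≤k)))

  -- Witness of incomparability: `m` is where the ways from the root to `x` and to `y` part.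
  record Fork (x y : Fin s) : Set where
    field
      {m a b} : Fin s
      a≢b     : a ≢ b
      pa      : parent a ≡ just m
      pb      : parent b ≡ just m
      a⊑x     : a ⊑ x
      b⊑y     : b ⊑ y

  child-towards : ∀ {a x} → a ⊑ x → a ≡ x ⊎ ∃ λ c → parent c ≡ just a × c ⊑ x
  child-towards self = inj₁ refl
  child-towards (below px s) with child-towards s
  ... | inj₁ refl           = inj₂ (_ , px , self)
  ... | inj₂ (c , pc , c⊑p) = inj₂ (c , pc , below px c⊑p)

  -- Induction down the way from the root to `x`. As long as the node reached is a proper ancestor
  -- of `y`, its child towards `x` either equals its child towards `y` or starts a fork.
  compare : ∀ x y → x ⊑ y ⊎ y ⊑ x ⊎ Fork x y
  compare x y = go (root-⊑ x)
    where
    go : ∀ {x} → root ⊑ x → x ⊑ y ⊎ y ⊑ x ⊎ Fork x y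
    go self = inj₁ (root-⊑ y)
    go (below {x} px s) with go s
    ... | inj₂ (inj₁ y⊑p) = inj₂ (inj₁ (below px y⊑p))
    ... | inj₂ (inj₂ f)   = inj₂ (inj₂ record
      { a≢b = a≢b ; pa = pa ; pb = pb ; a⊑x = below px a⊑x ; b⊑y = b⊑y })
      where open Fork f
    ... | inj₁ p⊑y with child-towards p⊑y
    ...   | inj₁ refl = inj₂ (inj₁ (below px self))
    ...   | inj₂ (c , pc , c⊑y) with x ≟ᶠ c
    ...     | yes refl = inj₁ c⊑y
    ...     | no  x≢c  = inj₂ (inj₂ record
      { a≢b = x≢c ; pa = px ; pb = pc ; a⊑x = self ; b⊑y = c⊑y })

  -- Paths along the ancestor order.

  descend : ∀ {a x k} → a ⊑ x → Walk T x k → Walk T a k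
  descend self         q = q
  descend (below px s) q = descend s (step (adj-sym (parent-adj px)) q)

  -- The walk stays below its first node, so the parent put in front is shallower than all of it and
  -- thus new.
  descend-path : ∀ {a x k} (s : a ⊑ x) (q : Walk T x k) → IsPath T q →
                 All (x ⊑_) (vertices T q) →
                 IsPath T (descend s q) × All (a ⊑_) (vertices T (descend s q))
  descend-path self         q unique under = unique , under
  descend-path (below px s) q unique under = descend-path s _
    (All.map (λ x⊑z p≡z → ℕ.<⇒≢ (ℕ.<-≤-trans (ℕ.≤-reflexive (sym (parent-depth px))) (⊑-depth x⊑z))
                            (cong depth p≡z)) under ∷ unique)
    (self ∷ All.map (⊑-trans (below px self)) under)

  descend-⊇ : ∀ {a x k z} (s : a ⊑ x) (q : Walk T x k) →
              z List.∈ vertices T q → z List.∈ vertices T (descend s q)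
  descend-⊇ self         q z∈q = z∈q
  descend-⊇ (below px s) q z∈q = descend-⊇ s _ (there z∈q)

  start∈ : ∀ {x k} (q : Walk T x k) → x List.∈ vertices T q
  start∈ stop       = here refl
  start∈ (step _ _) = here refl

  climb : ∀ {a m x k} → parent a ≡ just m → a ⊑ x → Walk T m k → Walk T x k
  climb pa self         q = step (parent-adj pa) q
  climb pa (below px s) q = step (parent-adj px) (climb pa s q)

  climb-⊇ : ∀ {a m x k z} (pa : parent a ≡ just m) (s : a ⊑ x) (q : Walk T m k) →
            z List.∈ vertices T q → z List.∈ vertices T (climb pa s q)
  climb-⊇ pa self        q z∈q = there z∈q
  climb-⊇ pa (below _ s) q z∈q = there (climb-⊇ pa s q z∈q)

  climb-path : ∀ {a m x k} (pa : parent a ≡ just m) (s : a ⊑ x) (q : Walk T m k) → IsPath T q →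
               All (λ z → ¬ a ⊑ z) (vertices T q) →
               IsPath T (climb pa s q) ×
               All (λ z → ¬ a ⊑ z ⊎ depth z ℕ.≤ depth x) (vertices T (climb pa s q))
  climb-path pa self q unique outside =
    All.map (λ a⋢z a≡z → a⋢z (subst (_ ⊑_) a≡z self)) outside ∷ unique ,
    inj₂ ℕ.≤-refl ∷ All.map inj₁ outside
  climb-path {a} pa (below {x} {p} px s) q unique outside with climb-path pa s q unique outside
  ... | path , where-z = All.map distinct where-z ∷ path , inj₂ ℕ.≤-refl ∷ All.map weaken where-z
    where
    p<x : depth p ℕ.< depth x
    p<x = ℕ.≤-reflexive (sym (parent-depth px))

    distinct : ∀ {z} → ¬ a ⊑ z ⊎ depth z ℕ.≤ depth p → x ≢ z
    distinct (inj₁ a⋢z) refl = a⋢z (below px s)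
    distinct (inj₂ z≤p) refl = ℕ.<⇒≱ p<x z≤p

    weaken : ∀ {z} → ¬ a ⊑ z ⊎ depth z ℕ.≤ depth p → ¬ a ⊑ z ⊎ depth z ℕ.≤ depth x
    weaken (inj₁ a⋢z) = inj₁ a⋢z
    weaken (inj₂ z≤p) = inj₂ (ℕ.≤-trans z≤p (ℕ.<⇒≤ p<x))

  stop-path : ∀ x → IsPath T (stop {u = x}) × All (x ⊑_) (vertices T (stop {u = x}))
  stop-path x = ([] ∷ []) , (self ∷ [])

  path-through : ∀ {a b c} → a ⊑ b → b ⊑ c →
                 ∃ λ (q : Walk T a c) → IsPath T q × b List.∈ vertices T q
  path-through {c = c} ab bc =
    let q₁ , u₁ = descend-path bc stop (proj₁ (stop-path c)) (proj₂ (stop-path c))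
        q₂ , _  = descend-path ab _ q₁ u₁
    in descend ab (descend bc stop) , q₂ , descend-⊇ ab _ (start∈ (descend bc stop))

  -- Up from `x` through `a` to `m`, then down through `b` to `y`.
  fork-path : ∀ {x y} (f : Fork x y) →
              ∃ λ (q : Walk T x y) → IsPath T q × Fork.m f List.∈ vertices T q
  fork-path {x} {y} f = climb pa a⊑x q , proj₁ (climb-path pa a⊑x q q-path (m-out ∷ q-out))
                      , climb-⊇ pa a⊑x q (here refl)
    where
    open Fork f
    q : Walk T m y
    q = step (adj-sym (parent-adj pb)) (descend b⊑y stop)

    down = descend-path b⊑y stop (proj₁ (stop-path y)) (proj₂ (stop-path y))

    m-out : ¬ a ⊑ m
    m-out a⊑m = ℕ.<⇒≱ (ℕ.≤-reflexive (sym (parent-depth pa))) (⊑-depth a⊑m)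

    same-depth : depth a ≡ depth b
    same-depth = trans (parent-depth pa) (sym (parent-depth pb))

    -- Two ancestors of `z` are comparable, and at equal depth they coincide.
    apart : ∀ {z} → b ⊑ z → ¬ a ⊑ z
    apart b⊑z a⊑z with ⊑-comparable a⊑z b⊑z
    ... | inj₁ a⊑b = a≢b (⊑-equal-depth a⊑b (ℕ.≤-reflexive (sym same-depth)))
    ... | inj₂ b⊑a = a≢b (sym (⊑-equal-depth b⊑a (ℕ.≤-reflexive same-depth)))

    q-out : All (λ z → ¬ a ⊑ z) (vertices T (descend b⊑y stop))
    q-out = All.map apart (proj₂ down)

    q-path : IsPath T q
    q-path = All.map (λ b⊑z m≡z → ℕ.<⇒≱ (ℕ.≤-reflexive (sym (parent-depth pb)))
               (subst (λ z → depth b ℕ.≤ depth z) (sym m≡z) (⊑-depth b⊑z))) (proj₂ down)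
             ∷ proj₁ down

  -- The node x receives the half-open block [lo x, lo x + weight x); it is cut into s + 1
  -- equal pieces, of which the child y gets piece number toℕ y + 1, so that lo x < lo y.
  weight : Fin s → ℕ
  weight x = suc s ^ (foldr _⊔_ 0 depth ∸ depth x)

  -- The counter is meant to be `depth x`; it makes the recursion along `parent` structural.
  offset : ℕ → Fin s → ℕ
  offset zero    x = 0
  offset (suc k) x with parent x
  ... | nothing = 0
  ... | just p  = offset k p ℕ.+ suc (toℕ x) ℕ.* weight x

  offset-suc : ∀ {k x p} → parent x ≡ just p → offset (suc k) x ≡ offset k p ℕ.+ suc (toℕ x) ℕ.* weight x
  offset-suc {k} {x} px with parent x
  offset-suc refl | just _ = refl

  lo : Fin s → ℕ
  lo x = offset (depth x) x

  end : Fin s → ℕ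
  end x = lo x ℕ.+ weight x

  weight>0 : ∀ x → 0 ℕ.< weight x
  weight>0 x = ℕ.m^n>0 (suc s) (foldr _⊔_ 0 depth ∸ depth x)

  weight-parent : ∀ {x p} → parent x ≡ just p → weight p ≡ suc s ℕ.* weight x
  weight-parent {x} {p} px = cong (suc s ^_)
    (trans (ℕ.+-∸-assoc 1 p<N) (cong (λ d → suc (foldr _⊔_ 0 depth ∸ d)) (sym (parent-depth px))))
    where
    -- `x` is deeper than `p`, so the exponent of `p` is at least 1 and its subtraction is not
    -- truncated.
    p<N : suc (depth p) ℕ.≤ foldr _⊔_ 0 depth
    p<N = subst (ℕ._≤ foldr _⊔_ 0 depth) (parent-depth px) (≤-maximum depth x)

  lo-parent : ∀ {x p} → parent x ≡ just p → lo x ≡ lo p ℕ.+ suc (toℕ x) ℕ.* weight x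
  lo-parent {x} {p} px = trans (cong (λ k → offset k x) (parent-depth px)) (offset-suc px)

  end-parent : ∀ {x p} → parent x ≡ just p → end x ≡ lo p ℕ.+ suc (suc (toℕ x)) ℕ.* weight x
  end-parent {x} {p} px rewrite lo-parent px =
    trans (ℕ.+-assoc (lo p) _ _) (cong (lo p ℕ.+_) (ℕ.+-comm _ (weight x)))

  child-lo : ∀ {x p} → parent x ≡ just p → lo p ℕ.< lo x
  child-lo {x} {p} px = subst (lo p ℕ.<_) (sym (lo-parent px))
    (ℕ.m<m+n (lo p) (ℕ.<-≤-trans (weight>0 x) (ℕ.m≤m+n _ _)))

  child-end : ∀ {x p} → parent x ≡ just p → end x ℕ.≤ end p
  child-end {x} {p} px = begin
    end x                                        ≡⟨ end-parent px ⟩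
    lo p ℕ.+ suc (suc (toℕ x)) ℕ.* weight x      ≤⟨ ℕ.+-monoʳ-≤ (lo p) (ℕ.*-monoˡ-≤ (weight x) (s≤s (toℕ<n x))) ⟩
    lo p ℕ.+ suc s ℕ.* weight x                  ≡⟨ cong (lo p ℕ.+_) (weight-parent px) ⟨
    end p                                        ∎
    where open ℕ.≤-Reasoning

  lo<end : ∀ x → lo x ℕ.< end x
  lo<end x = ℕ.m<m+n (lo x) (weight>0 x)

  ⊑-lo : ∀ {a x} → a ⊑ x → lo a ℕ.≤ lo x
  ⊑-lo self         = ℕ.≤-refl
  ⊑-lo (below px s) = ℕ.≤-trans (⊑-lo s) (ℕ.<⇒≤ (child-lo px))

  ⊑-end : ∀ {a x} → a ⊑ x → end x ℕ.≤ end a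
  ⊑-end self         = ℕ.≤-refl
  ⊑-end (below px s) = ℕ.≤-trans (child-end px) (⊑-end s)

  ⊏-lo : ∀ {a x} → a ⊑ x → a ≢ x → lo a ℕ.< lo x
  ⊏-lo self         a≢a = ⊥-elim (a≢a refl)
  ⊏-lo (below px s) _   = ℕ.≤-<-trans (⊑-lo s) (child-lo px)

  siblings-disjoint : ∀ {a b m} → parent a ≡ just m → parent b ≡ just m →
                      toℕ a ℕ.< toℕ b → end a ℕ.≤ lo b
  siblings-disjoint {a} {b} {m} pa pb a<b = begin
    end a                                    ≡⟨ end-parent pa ⟩
    lo m ℕ.+ suc (suc (toℕ a)) ℕ.* weight a  ≤⟨ ℕ.+-monoʳ-≤ (lo m) (ℕ.*-monoˡ-≤ (weight a) (s≤s a<b)) ⟩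
    lo m ℕ.+ suc (toℕ b) ℕ.* weight a        ≡⟨ cong (λ d → lo m ℕ.+ suc (toℕ b) ℕ.* (suc s ^ (foldr _⊔_ 0 depth ∸ d)))
                                                  (trans (parent-depth pa) (sym (parent-depth pb))) ⟩
    lo m ℕ.+ suc (toℕ b) ℕ.* weight b        ≡⟨ lo-parent pb ⟨
    lo b                                     ∎
    where open ℕ.≤-Reasoning

  fork-disjoint : ∀ {x y} → Fork x y → end x ℕ.≤ lo y ⊎ end y ℕ.≤ lo x
  fork-disjoint f with ℕ.<-cmp (toℕ (Fork.a f)) (toℕ (Fork.b f))
  ... | tri< a<b _ _ = inj₁ (ℕ.≤-trans (⊑-end a⊑x) (ℕ.≤-trans (siblings-disjoint pa pb a<b) (⊑-lo b⊑y)))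
    where open Fork f
  ... | tri≈ _ a≡b _ = ⊥-elim (Fork.a≢b f (toℕ-injective a≡b))
  ... | tri> _ _ b<a = inj₂ (ℕ.≤-trans (⊑-end b⊑y) (ℕ.≤-trans (siblings-disjoint pb pa b<a) (⊑-lo a⊑x)))
    where open Fork f

-- Boxes with integral corners

fromℕ : ℕ → ℚ
fromℕ n = mkℚ (+ n) 0 (coprime-sym (1-coprimeTo n))

fromℕ-mono : ∀ {m n} → m ℕ.≤ n → fromℕ m ℚ.≤ fromℕ n
fromℕ-mono m≤n = *≤* (ℤ.*-monoʳ-≤-nonNeg (+ 1) (ℤ.+≤+ m≤n))

fromℕ-cancel : ∀ {m n} → fromℕ m ℚ.≤ fromℕ n → m ℕ.≤ n
fromℕ-cancel (*≤* m≤n) = ℤ.drop‿+≤+ (ℤ.*-cancelʳ-≤-pos _ _ (+ 1) m≤n)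

natᴿ : ℕ → ℝ
natᴿ n = fromℚ (fromℕ n)

natᴿ-mono : ∀ {m n} → m ℕ.≤ n → natᴿ m ≤ᴿ natᴿ n
natᴿ-mono m≤n q<m = ℚ.<-≤-trans q<m (fromℕ-mono m≤n)

natᴿ-cancel : ∀ {m n} → natᴿ m ≤ᴿ natᴿ n → m ℕ.≤ n
-- If `n` were below `m`, the inclusion of lower cuts would put `n` below itself.
natᴿ-cancel m≤n = fromℕ-cancel (ℚ.≮⇒≥ λ n<m → ℚ.<-irrefl refl (m≤n n<m))

module _ {n b} (G : Graph n) (left right : Fin b → Fin n → ℕ) where
  open Graph G

  -- Two intervals meet exactly when each begins no later than the other ends; the larger left end
  -- is then a common point.
  boxRepresentation :
    (∀ i v → left i v ℕ.≤ right i v) →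
    (∀ {u v} → Adj u v → ∀ i → left i u ℕ.≤ right i v) →
    (∀ {u v} → u ≢ v → ¬ Adj u v → ∃ λ i → right i u ℕ.< left i v ⊎ right i v ℕ.< left i u) →
    BoxRepresentation G b
  boxRepresentation left≤right overlaps separate = record
    { box       = box
    ; represent = λ u v u≢v → mk⇔ (meet u v) (adjacent u v u≢v)
    }
    where
    box : Fin n → Box b
    box v i = record
      { lo = natᴿ (left i v) ; hi = natᴿ (right i v) ; lo≤hi = natᴿ-mono (left≤right i v) }

    meet : ∀ u v → Adj u v → Intersect (box u) (box v)
    meet u v uv = (λ i → natᴿ (left i u ⊔ left i v))
      , (λ i → natᴿ-mono (ℕ.m≤m⊔n (left i u) (left i v)) ,
               natᴿ-mono (ℕ.⊔-lub (left≤right i u) (overlaps (adj-sym uv) i)))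
      , (λ i → natᴿ-mono (ℕ.m≤n⊔m (left i u) (left i v)) ,
               natᴿ-mono (ℕ.⊔-lub (overlaps uv i) (left≤right i v)))

    adjacent : ∀ u v → u ≢ v → Intersect (box u) (box v) → Adj u v
    adjacent u v u≢v (x , x∈u , x∈v) with adj? u v
    ... | yes uv = uv
    ... | no ¬uv with separate u≢v ¬uv
    ...   | i , inj₁ u<v = ⊥-elim (ℕ.<⇒≱ u<v (natᴿ-cancel λ {q} l →
                             proj₂ (x∈u i) {q} (proj₁ (x∈v i) {q} l)))
    ...   | i , inj₂ v<u = ⊥-elim (ℕ.<⇒≱ v<u (natᴿ-cancel λ {q} l →
                             proj₂ (x∈v i) {q} (proj₁ (x∈u i) {q} l)))

-- The boxes of a tree decomposition

module _ {n} {G : Graph n} (D : TreeDecomposition G) (S : SpanningTree (TreeDecomposition.T D)) where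
  open Graph G
  open TreeDecomposition D
  open SpanningTree S using (depth; parent-depth)
  open Ancestors S

  abstract
    topNode : ∀ v → ∃ λ i → v ∈ X i × (∀ j → v ∈ X j → depth i ℕ.≤ depth j)
    topNode v = minimiser (λ i → v ∈? X i) depth (coversVertex v)

  top : Fin n → Fin size
  top v = proj₁ (topNode v)

  ∈-top : ∀ v → v ∈ X (top v)
  ∈-top v = proj₁ (proj₂ (topNode v))

  -- At a fork, coherence along the path from `top v` to `i` would put `v` into the bag of `m`,
  -- which is shallower than `top v`.
  top-⊑ : ∀ {v i} → v ∈ X i → top v ⊑ i
  top-⊑ {v} {i} v∈i with compare (top v) i
  ... | inj₁ t⊑i        = t⊑i
  ... | inj₂ (inj₁ i⊑t) = subst (_⊑ i) (⊑-equal-depth i⊑t (proj₂ (proj₂ (topNode v)) i v∈i)) self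
  ... | inj₂ (inj₂ f) with fork-path f
  ...   | q , path , m∈q = ⊥-elim (ℕ.<⇒≱
    (ℕ.<-≤-trans (ℕ.≤-reflexive (sym (parent-depth pa))) (⊑-depth a⊑x))
    (proj₂ (proj₂ (topNode v)) m (coherent q path m∈q (x∈p∩q⁺ (∈-top v , v∈i)))))
    where open Fork f

  ∈-between : ∀ {v i j} → top v ⊑ j → j ⊑ i → v ∈ X i → v ∈ X j
  ∈-between {v} tj ji v∈i with path-through tj ji
  ... | q , path , j∈q = coherent q path j∈q (x∈p∩q⁺ (∈-top v , v∈i))

  SharesBag : Fin n → Fin n → Set
  SharesBag u v = ∃ λ i → u ∈ X i × v ∈ X i

  sharesBag-comparable : ∀ {u v} → SharesBag u v → top u ⊑ top v ⊎ top v ⊑ top u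
  sharesBag-comparable (_ , u∈i , v∈i) = ⊑-comparable (top-⊑ u∈i) (top-⊑ v∈i)

  -- `top v` lies between `top u` and the node of the common bag.
  sharesBag-∈ : ∀ {u v} → SharesBag u v → top u ⊑ top v → u ∈ X (top v)
  sharesBag-∈ (_ , u∈i , v∈i) u⊑v = ∈-between u⊑v (top-⊑ v∈i) u∈i

  -- Colouring the vertices from the root down.

  open LexKey (depth ∘ top)

  abstract
    bagColouring : ∃ λ (θ : Fin n → Fin maxBagSize) → ∀ u v → key u ℕ.< key v → u ∈ X (top v) → θ u ≢ θ v
    bagColouring = Greedy.colouring key key-injective (X ∘ top) ∈-top (≤-maximum (∣_∣ ∘ X) ∘ top)

  θ : Fin n → Fin maxBagSize
  θ = proj₁ bagColouring

  θ-ordered : ∀ {u v} → key u ℕ.< key v → SharesBag u v → θ u ≢ θ v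
  θ-ordered {u} {v} u<v share = proj₂ bagColouring u v u<v (sharesBag-∈ share above)
    where
    above : top u ⊑ top v
    above with sharesBag-comparable share
    ... | inj₁ u⊑v = u⊑v
    -- The key order keeps `top v` from being shallower than `top u`, so the tops coincide.
    ... | inj₂ v⊑u = subst (_⊑ top v) (⊑-equal-depth v⊑u (key-level u v (ℕ.<⇒≤ u<v))) self

  θ-proper : ∀ {u v} → SharesBag u v → θ u ≡ θ v → u ≡ v
  θ-proper {u} {v} share@(i , u∈i , v∈i) eq with ℕ.<-cmp (key u) (key v)
  ... | tri< u<v _ _ = ⊥-elim (θ-ordered u<v share eq)
  ... | tri≈ _ u≡v _ = key-injective u≡v
  ... | tri> _ _ v<u = ⊥-elim (θ-ordered v<u (i , v∈i , u∈i) (sym eq))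

  UpNeighbour : Fin maxBagSize → Fin n → Fin n → Set
  UpNeighbour c v u = Adj u v × θ u ≡ c × u ∈ X (top v)

  upNeighbour? : ∀ c v → Dec (∃ (UpNeighbour c v))
  upNeighbour? c v = any? λ u → adj? u v ×-dec (θ u ≟ᶠ c) ×-dec (u ∈? X (top v))

  -- Coordinates are doubled so that the point of a vertex falls just before its own interval.
  point start finish : Fin n → ℕ
  point  v = 2 ℕ.* lo (top v)
  start  v = suc (point v)
  finish v = 2 ℕ.* end (top v)

  -- The interval of v in the coordinate of colour c: at most one neighbour of colour c lies
  -- in the bag of top v, so reaching left to its point meets no point of colour c that
  -- belongs to a non-neighbour with top above top v.
  leftOf : ∀ {c v} → Dec (θ v ≡ c) → Dec (∃ (UpNeighbour c v)) → ℕ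
  leftOf {v = v} (yes _) _             = point v
  leftOf         (no _)  (yes (u , _)) = point u
  leftOf {v = v} (no _)  (no _)        = start v

  rightOf : ∀ {c v} → Dec (θ v ≡ c) → ℕ
  rightOf {v = v} (yes _) = point v
  rightOf {v = v} (no _)  = finish v

  left right : Fin (suc maxBagSize) → Fin n → ℕ
  left  zero    v = start v
  left  (suc c) v = leftOf (θ v ≟ᶠ c) (upNeighbour? c v)
  right zero    v = finish v
  right (suc c) v = rightOf (θ v ≟ᶠ c)

  point<start : ∀ {u v} → top u ⊑ top v → point u ℕ.< start v
  point<start u⊑v = s≤s (ℕ.*-monoʳ-≤ 2 (⊑-lo u⊑v))

  point<point : ∀ {u v} → top u ⊑ top v → top u ≢ top v → point u ℕ.< point v
  point<point u⊑v u≢v = ℕ.*-monoʳ-< 2 (⊏-lo u⊑v u≢v)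

  start≤finish : ∀ {u v} → top u ⊑ top v ⊎ top v ⊑ top u → start u ℕ.≤ finish v
  start≤finish {u} {v} (inj₁ u⊑v) = ℕ.*-monoʳ-< 2 (ℕ.≤-<-trans (⊑-lo u⊑v) (lo<end (top v)))
  start≤finish {u} {v} (inj₂ v⊑u) = ℕ.*-monoʳ-< 2 (ℕ.<-≤-trans (lo<end (top u)) (⊑-end v⊑u))

  leftOf≤start : ∀ {c v} (a : Dec (θ v ≡ c)) (b : Dec (∃ (UpNeighbour c v))) → leftOf a b ℕ.≤ start v
  leftOf≤start (yes _) _                            = ℕ.n≤1+n _
  leftOf≤start (no _)  (yes (u , _ , _ , u∈top))    = ℕ.<⇒≤ (point<start (top-⊑ u∈top))
  leftOf≤start (no _)  (no _)                       = ℕ.≤-refl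

  left≤right : ∀ i v → left i v ℕ.≤ right i v
  left≤right zero    v = start≤finish (inj₁ self)
  left≤right (suc c) v with θ v ≟ᶠ c
  ... | yes _ = ℕ.≤-refl
  ... | no ≠c = ℕ.≤-trans (leftOf≤start (no ≠c) (upNeighbour? c v)) (start≤finish (inj₁ self))

  -- If `top u` is strictly above `top v`, even `start u` is at most `point v`. Otherwise `v` lies
  -- in the bag of `top u`, and properness makes it the very neighbour to which `u` is prolonged.
  leftOf≤point : ∀ {c u v} → Adj u v → θ v ≡ c → (≢c : θ u ≢ c) (b : Dec (∃ (UpNeighbour c u))) →
                 leftOf (no ≢c) b ℕ.≤ point v
  leftOf≤point {c} {u} {v} uv θv≡c ≢c b = go (sharesBag-comparable share)
    where
    share : SharesBag u v
    share = coversEdge uv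

    up : v ∈ X (top u) → (b : Dec (∃ (UpNeighbour c u))) → leftOf (no ≢c) b ℕ.≤ point v
    up v∈ (no none) = ⊥-elim (none (v , adj-sym uv , θv≡c , v∈))
    up v∈ (yes (u′ , _ , θu′≡c , u′∈)) = ℕ.≤-reflexive
      (cong point (θ-proper (top u , u′∈ , v∈) (trans θu′≡c (sym θv≡c))))

    go : top u ⊑ top v ⊎ top v ⊑ top u → leftOf (no ≢c) b ℕ.≤ point v
    go (inj₂ v⊑u) = up (sharesBag-∈ (proj₁ share , proj₂ (proj₂ share) , proj₁ (proj₂ share)) v⊑u) b
    go (inj₁ u⊑v) with top u ≟ᶠ top v
    ... | yes u≡v = up (subst (λ i → v ∈ X i) (sym u≡v) (∈-top v)) b
    ... | no  u≢v = ℕ.≤-trans (leftOf≤start (no ≢c) b) (point<point u⊑v u≢v)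

  adjacent-overlap : ∀ {u v} → Adj u v → ∀ i → left i u ℕ.≤ right i v
  adjacent-overlap uv zero = start≤finish (sharesBag-comparable (coversEdge uv))
  adjacent-overlap {u} {v} uv (suc c) with θ u ≟ᶠ c | θ v ≟ᶠ c
  ... | yes θu≡c | yes θv≡c = ⊥-elim (adj-irrefl (θ-proper (coversEdge uv) (trans θu≡c (sym θv≡c))) uv)
  ... | no  ≢c   | yes θv≡c = leftOf≤point uv θv≡c ≢c (upNeighbour? c u)
  -- `v` is not a point here: the intervals of the two comparable tops already meet, and the left
  -- end of `u` is at most `start u`.
  ... | a        | no _     = ℕ.≤-trans (leftOf≤start a (upNeighbour? c u))
                                (start≤finish (sharesBag-comparable (coversEdge uv)))

  -- The critical case is `v` prolonged to a neighbour `u′` of the colour of `u`. Both tops are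
  -- above `top v`, hence comparable, and `top u′` must be strictly below `top u`, so its point lies
  -- further right.
  point<leftOf : ∀ {u v} → u ≢ v → ¬ Adj u v → top u ⊑ top v →
                 (a : Dec (θ v ≡ θ u)) (b : Dec (∃ (UpNeighbour (θ u) v))) → point u ℕ.< leftOf a b
  point<leftOf {u} {v} u≢v ¬uv u⊑v (yes θv≡θu) _ = point<point u⊑v λ tops →
    u≢v (θ-proper (top v , subst (λ i → u ∈ X i) tops (∈-top u) , ∈-top v) (sym θv≡θu))
  point<leftOf u≢v ¬uv u⊑v (no _) (no _) = point<start u⊑v
  point<leftOf {u} {v} u≢v ¬uv u⊑v (no _) (yes (u′ , u′v , θu′≡θu , u′∈)) = go (⊑-comparable u⊑v (top-⊑ u′∈))
    where
    -- Otherwise u′, lying in the bag of top v, would also lie in that of top u.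
    apart : ¬ (top u′ ⊑ top u)
    apart u′⊑u = ¬uv (subst (λ x → Adj x v)
      (θ-proper (top u , ∈-between u′⊑u u⊑v u′∈ , ∈-top u) θu′≡θu) u′v)

    go : top u ⊑ top u′ ⊎ top u′ ⊑ top u → point u ℕ.< point u′
    go (inj₁ u⊑u′) = point<point u⊑u′ λ tops → apart (subst (_⊑ top u) tops self)
    go (inj₂ u′⊑u) = ⊥-elim (apart u′⊑u)

  right<left : ∀ {u v} → u ≢ v → ¬ Adj u v → top u ⊑ top v → right (suc (θ u)) u ℕ.< left (suc (θ u)) v
  right<left {u} {v} u≢v ¬uv u⊑v with θ u ≟ᶠ θ u
  ... | yes _ = point<leftOf u≢v ¬uv u⊑v (θ v ≟ᶠ θ u) (upNeighbour? (θ u) v)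
  ... | no ≢  = ⊥-elim (≢ refl)

  nonadjacent-separate : ∀ {u v} → u ≢ v → ¬ Adj u v →
                         ∃ λ i → right i u ℕ.< left i v ⊎ right i v ℕ.< left i u
  nonadjacent-separate {u} {v} u≢v ¬uv with compare (top u) (top v)
  ... | inj₁ u⊑v        = suc (θ u) , inj₁ (right<left u≢v ¬uv u⊑v)
  ... | inj₂ (inj₁ v⊑u) = suc (θ v) , inj₂ (right<left (≢-sym u≢v) (¬uv ∘ adj-sym) v⊑u)
  ... | inj₂ (inj₂ f) with fork-disjoint f
  -- Blocks may touch, since `end` is exclusive; the extra 1 in `start` makes the separation strict.
  ...   | inj₁ u≤v = zero , inj₁ (s≤s (ℕ.*-monoʳ-≤ 2 u≤v))
  ...   | inj₂ v≤u = zero , inj₂ (s≤s (ℕ.*-monoʳ-≤ 2 v≤u))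

  treeDecomposition⇒boxes : BoxRepresentation G (suc maxBagSize)
  treeDecomposition⇒boxes =
    boxRepresentation G left right left≤right adjacent-overlap nonadjacent-separate

tree⇒spanningTree : ∀ {s} {T : Graph s} → IsTree T → SpanningTree T
tree⇒spanningTree {zero}  record { nonEmpty = () }
tree⇒spanningTree {suc s} {T} isTree = BreadthFirst.spanningTree T zero (IsTree.connected isTree)

theorem2 : ∀ {n : ℕ} (G : Graph n) (b : ℕ) (t : ℤ) → IsBoxicity G b → IsTreewidth G t → + b ≤ t + + 2
theorem2 G b _ (_ , minimal) ((D , refl) , _) = subst (+ b ≤_) (sym width+2) (ℤ.+≤+ (minimal _
  (treeDecomposition⇒boxes D (tree⇒spanningTree isTree))))
  where
  open TreeDecomposition D
  -- One coordinate for each of the `maxBagSize` colours and one for the plain intervals; the width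
  -- is one less than `maxBagSize`.
  width+2 : width + + 2 ≡ + suc maxBagSize
  width+2 = trans (ℤ.+-assoc (+ maxBagSize) (ℤ.- ℤ.1ℤ) (+ 2)) (cong +_ (ℕ.+-comm maxBagSize 1))
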